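{- Let $p$ be a prime, $A\in \mathbb{Z}^{m\times n}$, $b\in \mathbb{Z}^m$, and $P:=\{x\in\mathbb{R}^n:Ax\leq b\}$. For a nonempty face $F$ of $P$, let $A_Fx\leq b_F$ denote the subsystem of $Ax\leq b$ consisting of the implicit equalities of $F$, i.e. the inequalities of $Ax\leq b$ that hold with equality at every point of $F$. Then the following statements are equivalent: (1) $Ax\leq b$ is totally dual $p$-adic; (2) for every nonempty face $F$ of $P$, the rows of $A_F$ form a $p$-adic generating set for a cone; (3) for every nonempty face $F$ of $P$, the rows of $A_F$ form a $p$-adic generating set for a subspace.
   Context: A $p$-adic rational is a number of the form $a/p^k$ with $a,k$ integers and $k\geq 0$; a vector is $p$-adic if all its entries are $p$-adic rationals. The system $Ax\leq b$ (with $A,b$ integral) is totally dual $p$-adic if for every $w\in\mathbb{Z}^n$ for which $\min\{b^\top y: A^\top y=w,\ y\geq \mathbf{0}\}$ has an optimal solution, it has a $p$-adic optimal solution. A finite set $\{a^1,\ldots,a^k\}\subseteq\mathbb{Z}^n$ is a $p$-adic generating set for a cone if every integral vector in the conic hull of these vectors can be written as a conic combination of them with $p$-adic (nonnegative) coefficients; it is a $p$-adic generating set for a subspace if every integral vector in their linear span can be written as a linear combination of them with $p$-adic coefficients.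
   Formalization: Rational numbers replace real numbers throughout: the points of P and of its faces, the vectors and values defining the faces, the dual solutions y, and the coefficients of conic and linear combinations are all rational; A, b and w are integral as stated. -}

module Defs where

open import Data.Nat using (ℕ; zero; suc; _^_)
open import Data.Integer using (ℤ; +_)
open import Data.Fin using (Fin; zero; suc)
open import Data.Rational using (ℚ; _/_; _+_; _*_; _≤_; 0ℚ)
open import Data.Product using (Σ; ∃; ∃-syntax; _×_; _,_)
open import Relation.Nullary using (¬_)
open import Relation.Binary.PropositionalEquality using (_≡_)

ℤ→ℚ : ℤ → ℚ
ℤ→ℚ a = a / 1

ℕ→ℚ : ℕ → ℚ
ℕ→ℚ k = (+ k) / 1

sumℚ : ∀ {n} → (Fin n → ℚ) → ℚ
sumℚ {zero}  f = 0ℚ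
sumℚ {suc n} f = f zero + sumℚ (λ i → f (suc i))

dotℤ : ∀ {n} → (Fin n → ℤ) → (Fin n → ℚ) → ℚ
dotℤ a x = sumℚ (λ j → ℤ→ℚ (a j) * x j)

dot : ∀ {n} → (Fin n → ℚ) → (Fin n → ℚ) → ℚ
dot c x = sumℚ (λ j → c j * x j)

IsPAdic : ℕ → ℚ → Set
IsPAdic p q = ∃[ k ] ∃[ a ] (q * ℕ→ℚ (p ^ k) ≡ ℤ→ℚ a)

rowComb : ∀ {m n} → (Fin m → Fin n → ℤ) → (Fin m → ℚ) → Fin n → ℚ
rowComb A y j = sumℚ (λ i → y i * ℤ→ℚ (A i j))

CombEq : ∀ {m n} → (Fin m → Fin n → ℤ) → (Fin m → ℚ) → (Fin n → ℤ) → Set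
CombEq A y w = ∀ j → rowComb A y j ≡ ℤ→ℚ (w j)

InP : ∀ {m n} → (Fin m → Fin n → ℤ) → (Fin m → ℤ) → (Fin n → ℚ) → Set
InP A b x = ∀ i → dotℤ (A i) x ≤ ℤ→ℚ (b i)

-- (c, δ) defines a nonempty face F = P ∩ {x : cx = δ}:
-- cx ≤ δ is valid for P and attained at some point of P
NonemptyFace : ∀ {m n} → (Fin m → Fin n → ℤ) → (Fin m → ℤ) → (Fin n → ℚ) → ℚ → Set
NonemptyFace A b c δ =
  (∀ x → InP A b x → dot c x ≤ δ) × (∃[ x ] (InP A b x × dot c x ≡ δ))

InFace : ∀ {m n} → (Fin m → Fin n → ℤ) → (Fin m → ℤ) → (Fin n → ℚ) → ℚ → (Fin n → ℚ) → Set
InFace A b c δ x = InP A b x × dot c x ≡ δ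

ImplicitEq : ∀ {m n} → (Fin m → Fin n → ℤ) → (Fin m → ℤ) → (Fin n → ℚ) → ℚ → Fin m → Set
ImplicitEq A b c δ i = ∀ x → InFace A b c δ x → dotℤ (A i) x ≡ ℤ→ℚ (b i)

SupportedOn : ∀ {m} → (Fin m → Set) → (Fin m → ℚ) → Set
SupportedOn S y = ∀ i → ¬ S i → y i ≡ 0ℚ

Nonneg : ∀ {m} → (Fin m → ℚ) → Set
Nonneg y = ∀ i → 0ℚ ≤ y i

PAdicVec : ∀ {m} → ℕ → (Fin m → ℚ) → Set
PAdicVec p y = ∀ i → IsPAdic p (y i)

PAdicGenCone : ∀ {m n} → ℕ → (Fin m → Fin n → ℤ) → (Fin m → Set) → Set
PAdicGenCone p A S = ∀ (w : _ → ℤ) →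
  (∃[ y ] (Nonneg y × SupportedOn S y × CombEq A y w)) →
  ∃[ y ] (Nonneg y × SupportedOn S y × PAdicVec p y × CombEq A y w)

PAdicGenSubspace : ∀ {m n} → ℕ → (Fin m → Fin n → ℤ) → (Fin m → Set) → Set
PAdicGenSubspace p A S = ∀ (w : _ → ℤ) →
  (∃[ y ] (SupportedOn S y × CombEq A y w)) →
  ∃[ y ] (SupportedOn S y × PAdicVec p y × CombEq A y w)

DualFeasible : ∀ {m n} → (Fin m → Fin n → ℤ) → (Fin n → ℤ) → (Fin m → ℚ) → Set
DualFeasible A w y = Nonneg y × CombEq A y w

DualOptimal : ∀ {m n} → (Fin m → Fin n → ℤ) → (Fin m → ℤ) → (Fin n → ℤ) → (Fin m → ℚ) → Set
DualOptimal A b w y = DualFeasible A w y ×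
  (∀ y' → DualFeasible A w y' → dotℤ b y ≤ dotℤ b y')

TotallyDualPAdic : ∀ {m n} → ℕ → (Fin m → Fin n → ℤ) → (Fin m → ℤ) → Set
TotallyDualPAdic p A b = ∀ (w : _ → ℤ) →
  (∃[ y ] DualOptimal A b w y) → ∃[ y ] (DualOptimal A b w y × PAdicVec p y)

AllFacesCone : ∀ {m n} → ℕ → (Fin m → Fin n → ℤ) → (Fin m → ℤ) → Set
AllFacesCone p A b = ∀ c δ → NonemptyFace A b c δ → PAdicGenCone p A (ImplicitEq A b c δ)

AllFacesSubspace : ∀ {m n} → ℕ → (Fin m → Fin n → ℤ) → (Fin m → ℤ) → Set
AllFacesSubspace p A b = ∀ c δ → NonemptyFace A b c δ → PAdicGenSubspace p A (ImplicitEq A b c δ)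

{-# OPTIONS --safe #-}

-- (1) ⇒ (2): a conic combination of the implicit equalities of F is a dual optimal solution for its
-- value w, and complementary slackness puts every optimal solution on those rows.
-- (2) ⇒ (3): add natural multiples of the rows to make the coefficients nonnegative, and subtract them
-- again from the p-adic conic combination.
-- (3) ⇒ (1): let F be the optimal face for w and ȳ a strictly complementary dual solution, so ȳ is
-- positive on the implicit equalities of F and zero elsewhere. By (3), w is also a p-adic combination z
-- of the same rows. Since the p-adic rationals are dense, some p-adic point of the line through z and ȳ
-- is close enough to ȳ to be nonnegative; being supported on the implicit equalities, it is optimal.
-- Strict complementarity comes from Farkas' lemma applied to the homogenised optimality system.
module Submission where

open import Defs
import Data.Nat as ℕ
import Data.Nat.DivMod as ℕ
import Data.Nat.Properties as ℕ
open import Data.Nat using (ℕ; zero; suc)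
open import Data.Nat.Primality using (Prime; prime)
import Data.Integer as ℤ
import Data.Integer.Properties as ℤ
open import Data.Integer using (ℤ)
open import Data.Fin using (Fin; zero; suc)
open import Data.Fin.Properties using (all?; ¬∀⟶∃¬)
import Data.Rational.Unnormalised as ℚᵘ
import Data.Rational.Unnormalised.Properties as ℚᵘ
open import Data.Rational using (ℚ; mkℚ; *≤*; ↥_; ↧_; ↧ₙ_; _+_; _*_; _-_; -_; _≤_; _<_; 0ℚ; 1ℚ; 1/_; positive; nonNegative; negative)
open import Data.Rational.Literals using (fromℤ)
open import Data.Rational.Properties
open import Data.Product using (Σ; ∃; ∃-syntax; _×_; _,_; proj₁; proj₂)
open import Data.Sum using (_⊎_; inj₁; inj₂)
open import Data.Empty using (⊥-elim)
open import Data.Vec.Functional using (_∷_)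
open import Function.Bundles using (_⇔_; mk⇔)
open import Level using (0ℓ)
open import Relation.Nullary using (¬_; yes; no)
open import Relation.Nullary.Decidable using (dec⇒maybe; decidable-stable)
open import Relation.Binary using (tri<; tri≈; tri>)
open import Relation.Binary.PropositionalEquality
open import Tactic.RingSolver using (solve-∀)
open import Tactic.RingSolver.Core.AlmostCommutativeRing using (AlmostCommutativeRing; fromCommutativeRing)

private
  variable
    m n : ℕ

-- Ordered-field arithmetic of the rationals.

ℚ-ring : AlmostCommutativeRing 0ℓ 0ℓ
ℚ-ring = fromCommutativeRing +-*-commutativeRing λ q → dec⇒maybe (0ℚ ≟ q)

0<1 : 0ℚ < 1ℚ
0<1 = positive⁻¹ 1ℚ

+-nonneg : ∀ {p q} → 0ℚ ≤ p → 0ℚ ≤ q → 0ℚ ≤ p + q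
+-nonneg = +-mono-≤

*-monoˡ : ∀ {r p q} → 0ℚ ≤ r → p ≤ q → r * p ≤ r * q
*-monoˡ {r} 0≤r = *-monoˡ-≤-nonNeg r {{nonNegative 0≤r}}

*-nonneg : ∀ {p q} → 0ℚ ≤ p → 0ℚ ≤ q → 0ℚ ≤ p * q
*-nonneg {p} {q} 0≤p 0≤q = subst (_≤ p * q) (*-zeroʳ p) (*-monoˡ 0≤p 0≤q)

*-pos : ∀ {p q} → 0ℚ < p → 0ℚ < q → 0ℚ < p * q
*-pos {p} {q} 0<p 0<q = positive⁻¹ (p * q) {{pos*pos⇒pos p {{positive 0<p}} q {{positive 0<q}}}}

square-pos : ∀ {q} → q ≢ 0ℚ → 0ℚ < q * q
square-pos {q} q≢0 with <-cmp q 0ℚ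
... | tri< q<0 _ _ = positive⁻¹ (q * q) {{neg*neg⇒pos q {{negative q<0}} q {{negative q<0}}}}
... | tri≈ _ q≡0 _ = ⊥-elim (q≢0 q≡0)
... | tri> _ _ 0<q = *-pos 0<q 0<q

inverse : ∀ {q} → 0ℚ < q → ∃[ r ] (0ℚ < r × r * q ≡ 1ℚ)
inverse {q} 0<q = 1/ q , positive⁻¹ (1/ q) {{1/pos⇒pos q}} , *-inverseˡ q
  where
  instance
    _ = positive 0<q
    _ = pos⇒nonZero q

≤∧≢⇒< : ∀ {p q} → p ≤ q → p ≢ q → p < q
≤∧≢⇒< {p} {q} p≤q p≢q with <-cmp p q
... | tri< p<q _ _ = p<q
... | tri≈ _ p≡q _ = ⊥-elim (p≢q p≡q)
... | tri> _ _ q<p = ⊥-elim (<-irrefl refl (<-≤-trans q<p p≤q))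

diff-nonneg : ∀ {p q} → p ≤ q → 0ℚ ≤ q - p
diff-nonneg {p} {q} p≤q = subst (_≤ q - p) (+-inverseʳ p) (+-monoˡ-≤ (- p) p≤q)

diff-pos : ∀ {p q} → p < q → 0ℚ < q - p
diff-pos {p} {q} p<q = subst (_< q - p) (+-inverseʳ p) (+-monoˡ-< (- p) p<q)

minus-def : ∀ p q → p - q ≡ p + - 1ℚ * q
minus-def = solve-∀ ℚ-ring

≤-by : ∀ {p q s} → 0ℚ ≤ s → q ≡ p + s → p ≤ q
≤-by {p} {s = s} 0≤s refl = subst (_≤ p + s) (+-identityʳ p) (+-monoʳ-≤ p 0≤s)

<-by : ∀ {p q s} → 0ℚ < s → q ≡ p + s → p < q
<-by {p} {s = s} 0<s refl = subst (_< p + s) (+-identityʳ p) (+-monoʳ-< p 0<s)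

inverse-1+ : ∀ {t} → 0ℚ ≤ t → ∃[ r ] (0ℚ < r × r * (1ℚ + t) ≡ 1ℚ)
inverse-1+ 0≤t = inverse (<-≤-trans 0<1 (≤-by 0≤t refl))

-- Finite sums and bilinearity of the dot product.

sum-cong : {f g : Fin n → ℚ} → (∀ i → f i ≡ g i) → sumℚ f ≡ sumℚ g
sum-cong {zero}  f≗g = refl
sum-cong {suc n} f≗g = cong₂ _+_ (f≗g zero) (sum-cong (λ i → f≗g (suc i)))

sum-zero : {f : Fin n → ℚ} → (∀ i → f i ≡ 0ℚ) → sumℚ f ≡ 0ℚ
sum-zero {zero}  f≗0 = refl
sum-zero {suc n} f≗0 = cong₂ _+_ (f≗0 zero) (sum-zero (λ i → f≗0 (suc i)))

sum-lin : ∀ a (f g : Fin n → ℚ) → sumℚ (λ i → f i + a * g i) ≡ sumℚ f + a * sumℚ g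
sum-lin {zero}  a f g = sym (trans (+-identityˡ _) (*-zeroʳ a))
sum-lin {suc n} a f g =
  trans (cong (f zero + a * g zero +_) (sum-lin a (λ i → f (suc i)) (λ i → g (suc i))))
        (regroup (f zero) a (g zero) _ _)
  where
  regroup : ∀ x a y s t → x + a * y + (s + a * t) ≡ x + s + a * (y + t)
  regroup = solve-∀ ℚ-ring

sum-nonneg : {f : Fin n → ℚ} → (∀ i → 0ℚ ≤ f i) → 0ℚ ≤ sumℚ f
sum-nonneg {zero}  0≤f = ≤-refl
sum-nonneg {suc n} 0≤f = +-nonneg (0≤f zero) (sum-nonneg (λ i → 0≤f (suc i)))

≤-sum : {f : Fin n → ℚ} → (∀ i → 0ℚ ≤ f i) → ∀ i → f i ≤ sumℚ f
≤-sum 0≤f zero    = ≤-by (sum-nonneg (λ i → 0≤f (suc i))) refl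
≤-sum {f = f} 0≤f (suc i) =
  ≤-trans (≤-sum (λ i → 0≤f (suc i)) i) (≤-by (0≤f zero) (+-comm (f zero) _))

dot-cong : ∀ {c c′ x x′ : Fin n → ℚ} → (∀ i → c i ≡ c′ i) → (∀ i → x i ≡ x′ i) → dot c x ≡ dot c′ x′
dot-cong c≗c′ x≗x′ = sum-cong (λ i → cong₂ _*_ (c≗c′ i) (x≗x′ i))

dot-comm : ∀ (c x : Fin n → ℚ) → dot c x ≡ dot x c
dot-comm c x = sum-cong (λ i → *-comm (c i) (x i))

dot-linʳ : ∀ a (c x y : Fin n → ℚ) → dot c (λ i → x i + a * y i) ≡ dot c x + a * dot c y
dot-linʳ a c x y = trans (sum-cong (λ i → expand (c i) (x i) a (y i)))
                         (sum-lin a (λ i → c i * x i) (λ i → c i * y i))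
  where
  expand : ∀ c x a y → c * (x + a * y) ≡ c * x + a * (c * y)
  expand = solve-∀ ℚ-ring

dot-+ʳ : ∀ (c x y : Fin n → ℚ) → dot c (λ i → x i + y i) ≡ dot c x + dot c y
dot-+ʳ c x y =
  trans (dot-cong {c = c} (λ _ → refl) (λ i → cong (x i +_) (sym (*-identityˡ (y i)))))
  (trans (dot-linʳ 1ℚ c x y) (cong (dot c x +_) (*-identityˡ _)))

dot-linˡ : ∀ a (c d x : Fin n → ℚ) → dot (λ i → c i + a * d i) x ≡ dot c x + a * dot d x
dot-linˡ a c d x = trans (dot-comm _ x) (trans (dot-linʳ a x c d)
  (cong₂ (λ s t → s + a * t) (dot-comm x c) (dot-comm x d)))

dot-zeroˡ : ∀ (x : Fin n → ℚ) → dot (λ _ → 0ℚ) x ≡ 0ℚ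
dot-zeroˡ x = sum-zero (λ i → *-zeroˡ (x i))

dot-zeroʳ : ∀ (c : Fin n → ℚ) → dot c (λ _ → 0ℚ) ≡ 0ℚ
dot-zeroʳ c = sum-zero (λ i → *-zeroʳ (c i))

dot-scaleʳ : ∀ a (c x : Fin n → ℚ) → dot c (λ i → a * x i) ≡ a * dot c x
dot-scaleʳ a c x =
  trans (dot-cong {c = c} (λ _ → refl) (λ i → sym (+-identityˡ (a * x i))))
  (trans (dot-linʳ a c (λ _ → 0ℚ) x)
  (trans (cong (_+ a * dot c x) (dot-zeroʳ c)) (+-identityˡ _)))

dot-scaleˡ : ∀ a (c x : Fin n → ℚ) → dot (λ i → a * c i) x ≡ a * dot c x
dot-scaleˡ a c x = trans (dot-comm _ x) (trans (dot-scaleʳ a x c) (cong (a *_) (dot-comm x c)))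

comb : (Fin m → Fin n → ℚ) → (Fin m → ℚ) → Fin n → ℚ
comb V y j = dot y (λ i → V i j)

-- Exchange of the two summations, by induction on the rows. It lets a combination of rows be
-- evaluated at a point row by row.
dot-comb : ∀ (V : Fin m → Fin n → ℚ) y x → dot (comb V y) x ≡ dot y (λ i → dot (V i) x)
dot-comb {zero}  V y x = dot-zeroˡ x
dot-comb {suc m} V y x = begin
  dot (λ j → y zero * V zero j + rest j) x         ≡⟨ dot-cong {x = x} (λ j → +-comm _ (rest j)) (λ _ → refl) ⟩
  dot (λ j → rest j + y zero * V zero j) x         ≡⟨ dot-linˡ (y zero) rest (V zero) x ⟩
  dot rest x + y zero * dot (V zero) x             ≡⟨ +-comm (dot rest x) _ ⟩
  y zero * dot (V zero) x + dot rest x             ≡⟨ cong (y zero * dot (V zero) x +_) (dot-comb (λ i → V (suc i)) (λ i → y (suc i)) x) ⟩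
  y zero * dot (V zero) x + dot (λ i → y (suc i)) (λ i → dot (V (suc i)) x) ∎
  where
  open ≡-Reasoning
  rest = comb (λ i → V (suc i)) (λ i → y (suc i))

unit : Fin n → Fin n → ℚ
unit zero    zero    = 1ℚ
unit zero    (suc j) = 0ℚ
unit (suc i) zero    = 0ℚ
unit (suc i) (suc j) = unit i j

unit-nonneg : ∀ (i : Fin n) → Nonneg (unit i)
unit-nonneg zero    zero    = <⇒≤ 0<1
unit-nonneg zero    (suc j) = ≤-refl
unit-nonneg (suc i) zero    = ≤-refl
unit-nonneg (suc i) (suc j) = unit-nonneg i j

unit-diag : ∀ (i : Fin n) → unit i i ≡ 1ℚ
unit-diag zero    = refl
unit-diag (suc i) = unit-diag i

dot-unitʳ : ∀ (c : Fin n → ℚ) i → dot c (unit i) ≡ c i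
dot-unitʳ c zero    = trans (cong₂ _+_ (*-identityʳ (c zero)) (dot-zeroʳ (λ i → c (suc i)))) (+-identityʳ _)
dot-unitʳ c (suc i) = trans (cong₂ _+_ (*-zeroʳ (c zero)) (dot-unitʳ (λ i → c (suc i)) i)) (+-identityˡ _)

-- Farkas' lemma.

InCone : (Fin m → Fin n → ℚ) → (Fin n → ℚ) → Set
InCone V c = ∃[ y ] (Nonneg y × ∀ j → comb V y j ≡ c j)

Separated : (Fin m → Fin n → ℚ) → (Fin n → ℚ) → Set
Separated V c = ∃[ x ] ((∀ i → dot (V i) x ≤ 0ℚ) × 0ℚ < dot c x)

-- Bartl's induction on the number of generators: if x₀ separates c from all generators
-- but V zero, project everything along V zero onto the forms that vanish at x₀.
module Projection {m n : ℕ} (V : Fin (suc m) → Fin n → ℚ) (c x₀ : Fin n → ℚ)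
  (V≤0 : ∀ i → dot (V (suc i)) x₀ ≤ 0ℚ) (c>0 : 0ℚ < dot c x₀)
  (r : ℚ) (0<r : 0ℚ < r) (r-inv : r * dot (V zero) x₀ ≡ 1ℚ) where

  v = V zero

  proj : (Fin n → ℚ) → Fin n → ℚ
  proj u j = u j + - (r * v j) * dot u x₀

  -- Adjointness: instead of projecting the form, one may shift the point along `x₀` onto the
  -- hyperplane where `v` vanishes.
  dot-proj : ∀ u x → dot (proj u) x ≡ dot u (λ j → x j + - (r * dot v x) * x₀ j)
  dot-proj u x = begin
    dot (proj u) x                                    ≡⟨ dot-cong {x = x} (λ j → cong (u j +_) (flip (v j) r (dot u x₀))) (λ _ → refl) ⟩
    dot (λ j → u j + - (r * dot u x₀) * v j) x        ≡⟨ dot-linˡ (- (r * dot u x₀)) u v x ⟩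
    dot u x + - (r * dot u x₀) * dot v x              ≡⟨ cong (dot u x +_) (flip (dot u x₀) r (dot v x)) ⟩
    dot u x + - (r * dot v x) * dot u x₀              ≡⟨ dot-linʳ (- (r * dot v x)) u x x₀ ⟨
    dot u (λ j → x j + - (r * dot v x) * x₀ j)        ∎
    where
    open ≡-Reasoning
    flip : ∀ a r b → - (r * a) * b ≡ - (r * b) * a
    flip = solve-∀ ℚ-ring

  -- Undoing the projection changes only the coefficient of `v`, which becomes `y₀`. Its sign is
  -- where separation enters: `c` is positive at `x₀` and the other generators are nonpositive
  -- there.
  lift-cone : InCone (λ i → proj (V (suc i))) (proj c) → InCone V c
  lift-cone (y , 0≤y , eq) = y₀ ∷ y , 0≤y₀∷y , comb≡c
    where
    s = λ i → dot (V (suc i)) x₀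
    y₀ = r * (dot c x₀ + - 1ℚ * dot y s)

    ys≤0 : 0ℚ ≤ - 1ℚ * dot y s
    ys≤0 = subst (0ℚ ≤_) (dot-scaleʳ (- 1ℚ) y s) (sum-nonneg λ i → *-nonneg (0≤y i)
             (subst (0ℚ ≤_) (minus (s i)) (diff-nonneg (V≤0 i))))
      where
      minus : ∀ s → 0ℚ - s ≡ - 1ℚ * s
      minus = solve-∀ ℚ-ring

    0≤y₀∷y : Nonneg (y₀ ∷ y)
    0≤y₀∷y zero    = *-nonneg (<⇒≤ 0<r) (+-nonneg (<⇒≤ c>0) ys≤0)
    0≤y₀∷y (suc i) = 0≤y i

    comb≡c : ∀ j → y₀ * v j + comb (λ i → V (suc i)) y j ≡ c j
    comb≡c j = begin
      y₀ * v j + C                                               ≡⟨ regroup r (dot c x₀) (dot y s) (v j) C ⟩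
      C + - (r * v j) * dot y s + r * v j * dot c x₀             ≡⟨ cong (_+ r * v j * dot c x₀) (dot-linʳ (- (r * v j)) y (λ i → V (suc i) j) s) ⟨
      comb (λ i → proj (V (suc i))) y j + r * v j * dot c x₀     ≡⟨ cong (_+ r * v j * dot c x₀) (eq j) ⟩
      proj c j + r * v j * dot c x₀                              ≡⟨ cancel (c j) (r * v j) (dot c x₀) ⟩
      c j                                                        ∎
      where
      open ≡-Reasoning
      C = comb (λ i → V (suc i)) y j
      regroup : ∀ r cx ys v C → r * (cx + - 1ℚ * ys) * v + C ≡ C + - (r * v) * ys + r * v * cx
      regroup = solve-∀ ℚ-ring
      cancel : ∀ c a b → c + - a * b + a * b ≡ c
      cancel = solve-∀ ℚ-ring

  -- The shifted point lies on the hyperplane of `v`, so the constraint of `V zero` holds with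
  -- equality; `dot-proj` transfers all the others.
  lift-separated : Separated (λ i → proj (V (suc i))) (proj c) → Separated V c
  lift-separated (x , Vx≤0 , cx>0) = x′ , Vx′≤0 , subst (0ℚ <_) (dot-proj c x) cx>0
    where
    x′ = λ j → x j + - (r * dot v x) * x₀ j

    Vx′≤0 : ∀ i → dot (V i) x′ ≤ 0ℚ
    Vx′≤0 zero    = ≤-reflexive (begin
      dot v x′                                    ≡⟨ dot-linʳ (- (r * dot v x)) v x x₀ ⟩
      dot v x + - (r * dot v x) * dot v x₀        ≡⟨ regroup (dot v x) r (dot v x₀) ⟩
      dot v x * (1ℚ - r * dot v x₀)               ≡⟨ cong (λ q → dot v x * (1ℚ - q)) r-inv ⟩
      dot v x * 0ℚ                                ≡⟨ *-zeroʳ (dot v x) ⟩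
      0ℚ                                          ∎)
      where
      open ≡-Reasoning
      regroup : ∀ a r b → a + - (r * a) * b ≡ a * (1ℚ - r * b)
      regroup = solve-∀ ℚ-ring
    Vx′≤0 (suc i) = subst (_≤ 0ℚ) (dot-proj (V (suc i)) x) (Vx≤0 i)

farkas : (V : Fin m → Fin n → ℚ) (c : Fin n → ℚ) → InCone V c ⊎ Separated V c
farkas {zero} V c with all? (λ j → c j ≟ 0ℚ)
... | yes c≗0 = inj₁ ((λ ()) , (λ ()) , λ j → sym (c≗0 j))
... | no ¬c≗0 with ¬∀⟶∃¬ _ _ (λ j → c j ≟ 0ℚ) ¬c≗0
-- Without generators the cone is the origin; at `c j` times the `j`-th unit vector the form `c`
-- takes the value `c j * c j`.
...   | j , cj≢0 = inj₂ ((λ k → c j * unit j k) , (λ ()) ,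
        subst (0ℚ <_) (sym (trans (dot-scaleʳ (c j) c (unit j)) (cong (c j *_) (dot-unitʳ c j)))) (square-pos cj≢0))
farkas {suc m} V c with farkas (λ i → V (suc i)) c
... | inj₁ (y , 0≤y , eq) = inj₁ (0ℚ ∷ y , 0≤0∷y ,
        λ j → trans (cong (_+ comb (λ i → V (suc i)) y j) (*-zeroˡ (V zero j))) (trans (+-identityˡ _) (eq j)))
  where
  0≤0∷y : Nonneg (0ℚ ∷ y)
  0≤0∷y zero    = ≤-refl
  0≤0∷y (suc i) = 0≤y i
-- Either `x₀` separates `V zero` as well, or `V zero` is positive at `x₀` and can be normalised
-- there for the projection.
... | inj₂ (x₀ , V≤0 , c>0) with dot (V zero) x₀ ≤? 0ℚ
...   | yes v≤0 = inj₂ (x₀ , (λ { zero → v≤0 ; (suc i) → V≤0 i }) , c>0)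
...   | no  v≰0 with inverse (≰⇒> v≰0)
...     | r , 0<r , r-inv with farkas (λ i → proj (V (suc i))) (proj c)
  where open Projection V c x₀ V≤0 c>0 r 0<r r-inv
...       | inj₁ cone = inj₁ (Projection.lift-cone V c x₀ V≤0 c>0 r 0<r r-inv cone)
...       | inj₂ sep  = inj₂ (Projection.lift-separated V c x₀ V≤0 c>0 r 0<r r-inv sep)

-- Duality and complementary slackness in linear programming.

module LinearProgram {m n : ℕ} (V : Fin m → Fin n → ℚ) (d : Fin m → ℚ) (w : Fin n → ℚ) where

  Primal : (Fin n → ℚ) → Set
  Primal x = ∀ i → dot (V i) x ≤ d i

  Dual : (Fin m → ℚ) → Set
  Dual y = Nonneg y × (∀ j → comb V y j ≡ w j)

  slack : (Fin n → ℚ) → Fin m → ℚ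
  slack x i = d i + - 1ℚ * dot (V i) x

  -- The gap between the two objectives is the sum of the products of multiplier and slack. Weak
  -- duality and complementary slackness are both read off from the signs of these products.
  duality-gap : ∀ {y} x → (∀ j → comb V y j ≡ w j) → dot d y ≡ dot w x + dot y (slack x)
  duality-gap {y} x Vy≡w = begin
    dot d y                                               ≡⟨ regroup (dot d y) (dot w x) ⟩
    dot w x + (dot d y + - 1ℚ * dot w x)                  ≡⟨ cong (λ q → dot w x + (dot d y + - 1ℚ * q)) wx≡ ⟩
    dot w x + (dot d y + - 1ℚ * dot y Vx)                 ≡⟨ cong (λ q → dot w x + (q + - 1ℚ * dot y Vx)) (dot-comm d y) ⟩
    dot w x + (dot y d + - 1ℚ * dot y Vx)                 ≡⟨ cong (dot w x +_) (dot-linʳ (- 1ℚ) y d Vx) ⟨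
    dot w x + dot y (slack x)                             ∎
    where
    open ≡-Reasoning
    Vx = λ i → dot (V i) x
    wx≡ : dot w x ≡ dot y Vx
    wx≡ = trans (dot-cong {x = x} (λ j → sym (Vy≡w j)) (λ _ → refl)) (dot-comb V y x)
    regroup : ∀ a b → a ≡ b + (a + - 1ℚ * b)
    regroup = solve-∀ ℚ-ring

  slack-nonneg : ∀ {x} → Primal x → Nonneg (slack x)
  slack-nonneg {x} Vx≤d i = subst (0ℚ ≤_) (minus-def (d i) (dot (V i) x)) (diff-nonneg (Vx≤d i))

  slack-zero : ∀ {x i} → dot (V i) x ≡ d i → slack x i ≡ 0ℚ
  slack-zero {x} {i} eq = trans (cong (λ q → q + - 1ℚ * dot (V i) x) (sym eq)) (cancel (dot (V i) x))
    where
    cancel : ∀ a → a + - 1ℚ * a ≡ 0ℚ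
    cancel = solve-∀ ℚ-ring

  weak-duality : ∀ {x y} → Primal x → Dual y → dot w x ≤ dot d y
  weak-duality {x} Vx≤d (0≤y , Vy≡w) =
    ≤-by (sum-nonneg (λ i → *-nonneg (0≤y i) (slack-nonneg Vx≤d i))) (duality-gap x Vy≡w)

  tight⇒equal-value : ∀ {x y} → (∀ j → comb V y j ≡ w j) →
    (∀ i → y i ≢ 0ℚ → dot (V i) x ≡ d i) → dot d y ≡ dot w x
  tight⇒equal-value {x} {y} Vy≡w tight =
    trans (duality-gap x Vy≡w) (trans (cong (dot w x +_) (sum-zero product-zero)) (+-identityʳ _))
    where
    product-zero : ∀ i → y i * slack x i ≡ 0ℚ
    product-zero i with y i ≟ 0ℚ
    ... | yes yi≡0 = trans (cong (_* slack x i) yi≡0) (*-zeroˡ (slack x i))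
    ... | no  yi≢0 = trans (cong (y i *_) (slack-zero (tight i yi≢0))) (*-zeroʳ (y i))

  -- A nonzero multiplier on a row with positive slack would contribute a positive term to a gap
  -- whose terms are all nonnegative.
  complementary-slackness : ∀ {x y} → Primal x → Dual y → dot d y ≤ dot w x →
    ∀ i → y i ≢ 0ℚ → dot (V i) x ≡ d i
  complementary-slackness {x} {y} Vx≤d (0≤y , Vy≡w) dy≤wx i yi≢0 with dot (V i) x ≟ d i
  ... | yes eq = eq
  ... | no neq = ⊥-elim (<-irrefl refl (<-≤-trans wx<dy dy≤wx))
    where
    0<slack : 0ℚ < slack x i
    0<slack = subst (0ℚ <_) (minus-def (d i) (dot (V i) x)) (diff-pos (≤∧≢⇒< (Vx≤d i) neq))
    wx<dy : dot w x < dot d y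
    wx<dy = <-by (<-≤-trans (*-pos (≤∧≢⇒< (0≤y i) (λ 0≡yi → yi≢0 (sym 0≡yi))) 0<slack)
                            (≤-sum (λ k → *-nonneg (0≤y k) (slack-nonneg Vx≤d k)) i))
                 (duality-gap x Vy≡w)

  -- A certificate that the form `c₀ * τ + dot c x` is nonpositive on the homogenised system
  -- `0 ≤ τ`, `V x ≤ τ d`, `τ β ≤ w x`.
  Multiplier : ℚ → ℚ → (Fin n → ℚ) → Set
  Multiplier β c₀ c = ∃[ z ] ∃[ t ] (Nonneg z × 0ℚ ≤ t ×
    (∀ j → comb V z j ≡ t * w j + c j) × dot d z + c₀ ≤ t * β)

  -- A solution of the homogenised system at which the form is positive. The case `τ = 0` describes
  -- recession directions.
  HomogeneousPoint : ℚ → ℚ → (Fin n → ℚ) → Set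
  HomogeneousPoint β c₀ c = ∃[ τ ] ∃[ x ] (0ℚ ≤ τ ×
    (∀ i → dot (V i) x ≤ τ * d i) × τ * β ≤ dot w x × 0ℚ < c₀ * τ + dot c x)

  homogeneous-farkas : ∀ β c₀ c → Multiplier β c₀ c ⊎ HomogeneousPoint β c₀ c
  homogeneous-farkas β c₀ c with farkas G (c₀ ∷ c)
    where
    -- G X ≤ 0 for X = (τ, x) says τ ≥ 0, w x ≥ β τ and V x ≤ τ d.
    G : Fin (suc (suc m)) → Fin (suc n) → ℚ
    G zero          = - 1ℚ ∷ λ _ → 0ℚ
    G (suc zero)    = β ∷ λ j → - 1ℚ * w j
    G (suc (suc i)) = - 1ℚ * d i ∷ V i
  ... | inj₁ (y , 0≤y , eq) = inj₁ (z , t , (λ i → 0≤y (suc (suc i))) , 0≤y (suc zero) , Vz≡ , dz≤)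
    where
    -- The multiplier of `0 ≤ τ` survives only as the slack of the inequality `dz≤`.
    s = y zero
    t = y (suc zero)
    z = λ i → y (suc (suc i))
    Vz≡ : ∀ j → comb V z j ≡ t * w j + c j
    Vz≡ j = trans (regroup s t (w j) (comb V z j)) (cong (t * w j +_) (eq (suc j)))
      where
      regroup : ∀ s t w C → C ≡ t * w + (s * 0ℚ + (t * (- 1ℚ * w) + C))
      regroup = solve-∀ ℚ-ring
    dz≤ : dot d z + c₀ ≤ t * β
    dz≤ = ≤-by (0≤y zero) (trans (regroup s t β (dot d z)) (cong (λ q → dot d z + q + s)
      (trans (cong (λ q → s * - 1ℚ + (t * β + q))
               (sym (trans (dot-scaleʳ (- 1ℚ) z d) (cong (- 1ℚ *_) (dot-comm z d)))))
             (eq zero))))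
      where
      regroup : ∀ s t b D → t * b ≡ D + (s * - 1ℚ + (t * b + - 1ℚ * D)) + s
      regroup = solve-∀ ℚ-ring
  ... | inj₂ (X , GX≤0 , cX>0) = inj₂ (τ , x , 0≤τ , Vx≤ , ≤wx , cX>0)
    where
    τ = X zero
    x = λ j → X (suc j)
    0≤τ : 0ℚ ≤ τ
    0≤τ = ≤-by (diff-nonneg (GX≤0 zero))
      (trans (regroup τ) (cong (λ q → 0ℚ + (0ℚ - (- 1ℚ * τ + q))) (sym (dot-zeroˡ x))))
      where
      regroup : ∀ τ → τ ≡ 0ℚ + (0ℚ - (- 1ℚ * τ + 0ℚ))
      regroup = solve-∀ ℚ-ring
    Vx≤ : ∀ i → dot (V i) x ≤ τ * d i
    Vx≤ i = ≤-by (diff-nonneg (GX≤0 (suc (suc i)))) (regroup τ (d i) (dot (V i) x))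
      where
      regroup : ∀ τ d v → τ * d ≡ v + (0ℚ - (- 1ℚ * d * τ + v))
      regroup = solve-∀ ℚ-ring
    ≤wx : τ * β ≤ dot w x
    ≤wx = ≤-by (diff-nonneg (GX≤0 (suc zero)))
      (trans (regroup τ β (dot w x)) (cong (λ q → τ * β + (0ℚ - (β * τ + q))) (sym (dot-scaleˡ (- 1ℚ) w x))))
      where
      regroup : ∀ τ b W → W ≡ τ * b + (0ℚ - (b * τ + - 1ℚ * W))
      regroup = solve-∀ ℚ-ring

-- Strictly complementary optimal solutions.

-- Since `mid` inherits each property from either argument, folding it over one witness per index
-- collects all the properties in a single vector.
midpoint-closed⇒common : ∀ {k} (C : (Fin m → ℚ) → Set) (Q : Fin k → (Fin m → ℚ) → Set)
  (mid : (Fin m → ℚ) → (Fin m → ℚ) → Fin m → ℚ) →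
  (∀ {y z} → C y → C z → C (mid y z)) →
  (∀ {i y z} → C y → C z → Q i y ⊎ Q i z → Q i (mid y z)) →
  ∃ C → (∀ i → ∃[ y ] (C y × Q i y)) → ∃[ y ] (C y × ∀ i → Q i y)
midpoint-closed⇒common {k = zero}  C Q mid C-mid Q-mid (y , Cy) each = y , Cy , λ ()
midpoint-closed⇒common {k = suc k} C Q mid C-mid Q-mid inhabited each
  with each zero | midpoint-closed⇒common C (λ i → Q (suc i)) mid C-mid Q-mid inhabited (λ i → each (suc i))
... | y , Cy , Q₀y | z , Cz , Qz = mid y z , C-mid Cy Cz , λ where
  zero    → Q-mid Cy Cz (inj₁ Q₀y)
  (suc i) → Q-mid Cy Cz (inj₂ (Qz i))

module StrictComplementarity {m n : ℕ} (V : Fin m → Fin n → ℚ) (d : Fin m → ℚ) (w : Fin n → ℚ)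
  (y* : Fin m → ℚ) (dual* : LinearProgram.Dual V d w y*)
  (optimal* : ∀ y → LinearProgram.Dual V d w y → dot d y* ≤ dot d y) where

  open LinearProgram V d w

  β = dot d y*

  Optimal : (Fin m → ℚ) → Set
  Optimal y = Dual y × dot d y ≤ β

  Face : (Fin n → ℚ) → Set
  Face x = Primal x × dot w x ≡ β

  average : ℚ → (Fin m → ℚ) → (Fin m → ℚ) → Fin m → ℚ
  average r y z i = r * (y i + z i)

  dot-average : ∀ {k} r (c x y : Fin k → ℚ) → dot c (λ i → r * (x i + y i)) ≡ r * (dot c x + dot c y)
  dot-average r c x y = trans (dot-scaleʳ r c (λ i → x i + y i)) (cong (r *_) (dot-+ʳ c x y))

  comb-average : ∀ r y z j → comb V (average r y z) j ≡ r * (comb V y j + comb V z j)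
  comb-average r y z j = trans (dot-comm (average r y z) col)
    (trans (dot-average r col y z) (cong₂ (λ s t → r * (s + t)) (dot-comm col y) (dot-comm col z)))
    where col = λ i → V i j

  -- The sum of `y` and `z` represents `1 + t` times `w` at cost at most `1 + t` times `β`, and `r`
  -- is the reciprocal of `1 + t`.
  absorb : ∀ {r t y z} → 0ℚ < r → r * (1ℚ + t) ≡ 1ℚ → Optimal y → Nonneg z →
    (∀ j → comb V z j ≡ t * w j) → dot d z ≤ t * β → Optimal (average r y z)
  absorb {r} {t} {y} {z} 0<r r-inv ((0≤y , Vy≡w) , dy≤β) 0≤z Vz≡tw dz≤tβ =
    ((λ i → *-nonneg (<⇒≤ 0<r) (+-nonneg (0≤y i) (0≤z i))) ,
     (λ j → trans (comb-average r y z j) (trans (cong₂ (λ p q → r * (p + q)) (Vy≡w j) (Vz≡tw j)) (normalise (w j))))) ,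
    subst₂ _≤_ (sym (dot-average r d y z)) (normalise β) (*-monoˡ (<⇒≤ 0<r) (+-mono-≤ dy≤β dz≤tβ))
    where
    factor : ∀ r t a → r * (a + t * a) ≡ r * (1ℚ + t) * a
    factor = solve-∀ ℚ-ring
    normalise : ∀ a → r * (a + t * a) ≡ a
    normalise a = trans (factor r t a) (trans (cong (_* a) r-inv) (*-identityˡ a))

  module Rescale {r τ : ℚ} {x : Fin n → ℚ} (0<r : 0ℚ < r) (r-inv : r * τ ≡ 1ℚ) where

    rτ : ∀ a → r * (τ * a) ≡ a
    rτ a = trans (sym (*-assoc r τ a)) (trans (cong (_* a) r-inv) (*-identityˡ a))

    -- Division by `τ` dehomogenises. The objective is then at least `β` by assumption and at most
    -- `β` by weak duality against `y*`.
    rescale-face : (∀ i → dot (V i) x ≤ τ * d i) → τ * β ≤ dot w x → Face (λ j → r * x j)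
    rescale-face Vx≤ ≤wx = primal , ≤-antisym (weak-duality primal dual*)
        (subst₂ _≤_ (rτ β) (sym (dot-scaleʳ r w x)) (*-monoˡ (<⇒≤ 0<r) ≤wx))
      where
      primal : Primal (λ j → r * x j)
      primal i = subst₂ _≤_ (sym (dot-scaleʳ r (V i) x)) (rτ (d i)) (*-monoˡ (<⇒≤ 0<r) (Vx≤ i))

    rescale-strict : ∀ i → dot (V i) x < τ * d i → dot (V i) (λ j → r * x j) < d i
    rescale-strict i Vx< = subst₂ _<_ (sym (dot-scaleʳ r (V i) x)) (rτ (d i))
      (*-monoʳ-<-pos r {{positive 0<r}} Vx<)

  optimal-y* : Optimal y*
  optimal-y* = dual* , ≤-refl

  -- Strong duality, with `τ` itself as the form to be tested. A point with positive `τ` rescales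
  -- into the face; a certificate, absorbed into `y*`, would lower the dual value to at most
  -- `β - r`.
  face-nonempty : ∃ Face
  face-nonempty with homogeneous-farkas β 1ℚ (λ _ → 0ℚ)
  ... | inj₂ (τ , x , 0≤τ , Vx≤ , ≤wx , pos) =
    let r , 0<r , r-inv = inverse (subst (0ℚ <_) τ≡ pos)
    in  (λ j → r * x j) , Rescale.rescale-face {x = x} 0<r r-inv Vx≤ ≤wx
    where
    τ≡ : 1ℚ * τ + dot (λ _ → 0ℚ) x ≡ τ
    τ≡ = trans (cong₂ _+_ (*-identityˡ τ) (dot-zeroˡ x)) (+-identityʳ τ)
  ... | inj₁ (z , t , 0≤z , 0≤t , Vz≡ , dz+1≤) = ⊥-elim (<-irrefl refl (<-≤-trans β-r<β β≤β-r))
    where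
    r = proj₁ (inverse-1+ 0≤t)
    0<r = proj₁ (proj₂ (inverse-1+ 0≤t))
    r-inv = proj₂ (proj₂ (inverse-1+ 0≤t))
    dz≤ : dot d z ≤ t * β
    dz≤ = ≤-trans (≤-by (<⇒≤ 0<1) refl) dz+1≤
    better : Optimal (average r y* z)
    better = absorb {t = t} 0<r r-inv optimal-y* 0≤z (λ j → trans (Vz≡ j) (+-identityʳ _)) dz≤
    β-r<β : β - r < β
    β-r<β = <-by 0<r (regroup β r)
      where
      regroup : ∀ b r → b ≡ b - r + r
      regroup = solve-∀ ℚ-ring
    β≤β-r : β ≤ β - r
    β≤β-r = begin
      β                                    ≤⟨ optimal* _ (proj₁ better) ⟩
      dot d (average r y* z)               ≡⟨ dot-average r d y* z ⟩
      r * (β + dot d z)                    ≡⟨ regroup r β (dot d z) ⟩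
      r * (β + (dot d z + 1ℚ)) - r         ≤⟨ +-monoˡ-≤ (- r) (*-monoˡ (<⇒≤ 0<r) (+-monoʳ-≤ β dz+1≤)) ⟩
      r * (β + t * β) - r                  ≡⟨ factor r t β ⟩
      r * (1ℚ + t) * β - r                 ≡⟨ cong (λ q → q * β - r) r-inv ⟩
      1ℚ * β - r                           ≡⟨ cong (_- r) (*-identityˡ β) ⟩
      β - r                                ∎
      where
      open ≤-Reasoning
      regroup : ∀ r b D → r * (b + D) ≡ r * (b + (D + 1ℚ)) - r
      regroup = solve-∀ ℚ-ring
      factor : ∀ r t a → r * (a + t * a) - r ≡ r * (1ℚ + t) * a - r
      factor = solve-∀ ℚ-ring

  StrictAt : Fin m → Set
  StrictAt i = ∃[ x ] (Face x × dot (V i) x < d i)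

  -- The form tested is the homogenised slack of row `i`. A certificate against positive slack
  -- yields an optimal solution that uses row `i`.
  positive-or-strict : ∀ i → (∃[ y ] (Optimal y × 0ℚ < y i)) ⊎ StrictAt i
  positive-or-strict i with homogeneous-farkas β (d i) (λ j → - 1ℚ * V i j)
  ... | inj₁ (z , t , 0≤z , 0≤t , Vz≡ , dz+d≤) =
    let r , 0<r , r-inv = inverse-1+ 0≤t
    in  inj₁ (average r y* z′ , absorb {t = t} 0<r r-inv optimal-y* 0≤z′ Vz′≡ dz′≤ , *-pos 0<r 0<y*+z′)
    where
    -- The term of row `i` on the right of `Vz≡` moves to the left as one extra unit of that row.
    z′ = λ k → z k + unit i k
    0≤z′ : Nonneg z′
    0≤z′ k = +-nonneg (0≤z k) (unit-nonneg i k)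
    Vz′≡ : ∀ j → comb V z′ j ≡ t * w j
    Vz′≡ j = begin
      comb V z′ j                              ≡⟨ dot-comm z′ col ⟩
      dot col z′                               ≡⟨ dot-+ʳ col z (unit i) ⟩
      dot col z + dot col (unit i)             ≡⟨ cong₂ _+_ (trans (dot-comm col z) (Vz≡ j)) (dot-unitʳ col i) ⟩
      t * w j + - 1ℚ * V i j + V i j           ≡⟨ cancel (t * w j) (V i j) ⟩
      t * w j                                  ∎
      where
      open ≡-Reasoning
      col = λ k → V k j
      cancel : ∀ a v → a + - 1ℚ * v + v ≡ a
      cancel = solve-∀ ℚ-ring
    dz′≤ : dot d z′ ≤ t * β
    dz′≤ = subst (_≤ t * β) (sym (trans (dot-+ʳ d z (unit i)) (cong (dot d z +_) (dot-unitʳ d i)))) dz+d≤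
    0<y*+z′ : 0ℚ < y* i + (z i + unit i i)
    0<y*+z′ = <-≤-trans 0<1 (≤-by (+-nonneg (proj₁ dual* i) (0≤z i))
      (trans (cong (λ q → y* i + (z i + q)) (unit-diag i)) (regroup (y* i) (z i))))
      where
      regroup : ∀ a b → a + (b + 1ℚ) ≡ 1ℚ + (a + b)
      regroup = solve-∀ ℚ-ring
  ... | inj₂ (τ , x , 0≤τ , Vx≤ , ≤wx , pos) with face-nonempty
  ...   | x₀ , Vx₀≤d , wx₀≡β =
    -- As `τ` may be zero, a face point `x₀` is added first: this makes the scale `1 + τ` positive
    -- and keeps the inequality at row `i` strict.
    let r , 0<r , r-inv = inverse-1+ 0≤τ
        open Rescale {x = λ j → x₀ j + x j} 0<r r-inv
    in  inj₂ (_ , rescale-face Vx′≤ ≤wx′ , rescale-strict i Vx′<)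
    where
    1+τ : ∀ a → a + τ * a ≡ (1ℚ + τ) * a
    1+τ a = trans (cong (_+ τ * a) (sym (*-identityˡ a))) (sym (*-distribʳ-+ a 1ℚ τ))
    Vx′≤ : ∀ k → dot (V k) (λ j → x₀ j + x j) ≤ (1ℚ + τ) * d k
    Vx′≤ k = subst₂ _≤_ (sym (dot-+ʳ (V k) x₀ x)) (1+τ (d k)) (+-mono-≤ (Vx₀≤d k) (Vx≤ k))
    ≤wx′ : (1ℚ + τ) * β ≤ dot w (λ j → x₀ j + x j)
    ≤wx′ = subst₂ _≤_ (1+τ β) (sym (dot-+ʳ w x₀ x)) (+-mono-≤ (≤-reflexive (sym wx₀≡β)) ≤wx)
    Vx< : dot (V i) x < τ * d i
    Vx< = <-by pos (trans (regroup τ (d i) (dot (V i) x))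
      (cong (λ q → dot (V i) x + (d i * τ + q)) (sym (dot-scaleˡ (- 1ℚ) (V i) x))))
      where
      regroup : ∀ τ d v → τ * d ≡ v + (d * τ + - 1ℚ * v)
      regroup = solve-∀ ℚ-ring
    Vx′< : dot (V i) (λ j → x₀ j + x j) < (1ℚ + τ) * d i
    Vx′< = subst₂ _<_ (sym (dot-+ʳ (V i) x₀ x)) (1+τ (d i)) (+-mono-≤-< (Vx₀≤d i) Vx<)

  -- Positivity at `i` survives averaging with a nonnegative vector, and `StrictAt i` does not
  -- mention the solution, so one optimal solution serves all rows.
  strict-complementarity : ∃[ y ] (Optimal y × ∀ i → 0ℚ < y i ⊎ StrictAt i)
  strict-complementarity =
    midpoint-closed⇒common Optimal (λ i y → 0ℚ < y i ⊎ StrictAt i) (average r)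
      (λ opt-y ((0≤z , Vz≡w) , dz≤β) → absorb {t = 1ℚ} 0<r r-inv opt-y 0≤z
        (λ j → trans (Vz≡w j) (sym (*-identityˡ (w j)))) (subst (_ ≤_) (sym (*-identityˡ β)) dz≤β))
      positive-average (y* , optimal-y*)
      (λ i → each (positive-or-strict i))
    where
    -- This is one half, the case `t = 1` of `absorb`.
    r = proj₁ (inverse-1+ (<⇒≤ 0<1))
    0<r = proj₁ (proj₂ (inverse-1+ (<⇒≤ 0<1)))
    r-inv = proj₂ (proj₂ (inverse-1+ (<⇒≤ 0<1)))
    positive-average : ∀ {i y z} → Optimal y → Optimal z →
      (0ℚ < y i ⊎ StrictAt i) ⊎ (0ℚ < z i ⊎ StrictAt i) → 0ℚ < average r y z i ⊎ StrictAt i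
    positive-average {i} _ opt-z (inj₁ (inj₁ 0<yi)) = inj₁ (*-pos 0<r (+-mono-<-≤ 0<yi (proj₁ (proj₁ opt-z) i)))
    positive-average {i} opt-y _ (inj₂ (inj₁ 0<zi)) = inj₁ (*-pos 0<r (+-mono-≤-< (proj₁ (proj₁ opt-y) i) 0<zi))
    positive-average _ _ (inj₁ (inj₂ strict)) = inj₂ strict
    positive-average _ _ (inj₂ (inj₂ strict)) = inj₂ strict
    each : ∀ {i} → (∃[ y ] (Optimal y × 0ℚ < y i)) ⊎ StrictAt i → ∃[ y ] (Optimal y × (0ℚ < y i ⊎ StrictAt i))
    each (inj₁ (y , opt , 0<yi)) = y , opt , inj₁ 0<yi
    each (inj₂ strict)           = y* , optimal-y* , inj₂ strict

-- Integers inside the rationals, common denominators and rounding.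

-- `a / 1` passes through normalisation and is stuck for a variable `a`, whereas `fromℤ a` is an
-- explicit fraction on which the operations compute.
ℤ→ℚ≡fromℤ : ∀ a → ℤ→ℚ a ≡ fromℤ a
ℤ→ℚ≡fromℤ a = ↥p/↧p≡p (fromℤ a)

ℤ→ℚ-+ : ∀ a b → ℤ→ℚ (a ℤ.+ b) ≡ ℤ→ℚ a + ℤ→ℚ b
ℤ→ℚ-+ a b = trans (cong ℤ→ℚ (cong₂ ℤ._+_ (sym (ℤ.*-identityʳ a)) (sym (ℤ.*-identityʳ b))))
                  (sym (cong₂ _+_ (ℤ→ℚ≡fromℤ a) (ℤ→ℚ≡fromℤ b)))

ℤ→ℚ-* : ∀ a b → ℤ→ℚ (a ℤ.* b) ≡ ℤ→ℚ a * ℤ→ℚ b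
ℤ→ℚ-* a b = sym (cong₂ _*_ (ℤ→ℚ≡fromℤ a) (ℤ→ℚ≡fromℤ b))

ℤ→ℚ-mono : ∀ {a b} → a ℤ.≤ b → ℤ→ℚ a ≤ ℤ→ℚ b
ℤ→ℚ-mono {a} {b} a≤b = subst₂ _≤_ (sym (ℤ→ℚ≡fromℤ a)) (sym (ℤ→ℚ≡fromℤ b))
  (*≤* (ℤ.*-monoʳ-≤-nonNeg (ℤ.+ 1) a≤b))

ℕ→ℚ-+ : ∀ k l → ℕ→ℚ (k ℕ.+ l) ≡ ℕ→ℚ k + ℕ→ℚ l
ℕ→ℚ-+ k l = trans (cong ℤ→ℚ (ℤ.pos-+ k l)) (ℤ→ℚ-+ (ℤ.+ k) (ℤ.+ l))

ℕ→ℚ-* : ∀ k l → ℕ→ℚ (k ℕ.* l) ≡ ℕ→ℚ k * ℕ→ℚ l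
ℕ→ℚ-* k l = trans (cong ℤ→ℚ (ℤ.pos-* k l)) (ℤ→ℚ-* (ℤ.+ k) (ℤ.+ l))

ℕ→ℚ-mono : ∀ {k l} → k ℕ.≤ l → ℕ→ℚ k ≤ ℕ→ℚ l
ℕ→ℚ-mono k≤l = ℤ→ℚ-mono (ℤ.+≤+ k≤l)

ℕ→ℚ-nonneg : ∀ k → 0ℚ ≤ ℕ→ℚ k
ℕ→ℚ-nonneg k = ℕ→ℚ-mono {0} {k} ℕ.z≤n

≤-natural : ∀ q → ∃[ k ] q ≤ ℕ→ℚ k
-- The numerator is a bound because the denominator is at least one.
≤-natural q@(mkℚ (ℤ.+ k) d-1 _) = k , subst (q ≤_) (sym (ℤ→ℚ≡fromℤ (ℤ.+ k)))
  (*≤* (ℤ.*-monoˡ-≤-nonNeg (ℤ.+ k) {ℤ.+ 1} {ℤ.+ suc d-1} (ℤ.+≤+ (ℕ.s≤s ℕ.z≤n))))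
≤-natural q@(mkℚ ℤ.-[1+ _ ] _ _) = 0 , <⇒≤ (negative⁻¹ q)

≤-natural-uniform : ∀ (q : Fin n → ℚ) → ∃[ k ] (∀ i → q i ≤ ℕ→ℚ k)
≤-natural-uniform {zero}  q = 0 , λ ()
≤-natural-uniform {suc n} q with ≤-natural (q zero) | ≤-natural-uniform (λ i → q (suc i))
... | k , q₀≤k | l , q≤l = k ℕ.+ l , λ where
  zero    → ≤-trans q₀≤k (ℕ→ℚ-mono (ℕ.m≤m+n k l))
  (suc i) → ≤-trans (q≤l i) (ℕ→ℚ-mono (ℕ.m≤n+m l k))

*-denominator : ∀ q → q * ℕ→ℚ (↧ₙ q) ≡ ℤ→ℚ (↥ q)
*-denominator q@record{} = trans (cong (q *_) (ℤ→ℚ≡fromℤ (↧ q))) (trans q*d≡fromℤ (sym (ℤ→ℚ≡fromℤ (↥ q))))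
  where
  q*d≡fromℤ : q * fromℤ (↧ q) ≡ fromℤ (↥ q)
  q*d≡fromℤ = toℚᵘ-injective (ℚᵘ.≃-trans (toℚᵘ-homo-* q (fromℤ (↧ q)))
    (ℚᵘ.*≡* (trans (ℤ.*-identityʳ _) (cong (λ k → ↥ q ℤ.* ℤ.+ k) (sym (ℕ.*-identityʳ (↧ₙ q)))))))

common-denominator : ∀ (q : Fin n → ℚ) →
  ∃[ D ] Σ (Fin n → ℤ) λ u → (ℕ.NonZero D × ∀ i → q i * ℕ→ℚ D ≡ ℤ→ℚ (u i))
common-denominator {zero}  q = 1 , (λ ()) , _ , λ ()
common-denominator {suc n} q with common-denominator (λ i → q (suc i))
... | D , u , D≢0 , qD≡u = ↧ₙ (q zero) ℕ.* D , u′ , ℕ.m*n≢0 (↧ₙ (q zero)) D {{_}} {{D≢0}} , eq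
  where
  d₀ = ↧ₙ (q zero)
  u′ : Fin (suc _) → ℤ
  u′ = ↥ (q zero) ℤ.* ℤ.+ D ∷ λ i → u i ℤ.* ℤ.+ d₀
  swap : ∀ q d D → q * (d * D) ≡ q * D * d
  swap = solve-∀ ℚ-ring
  eq : ∀ i → q i * ℕ→ℚ (d₀ ℕ.* D) ≡ ℤ→ℚ (u′ i)
  eq zero = trans (cong (q zero *_) (ℕ→ℚ-* d₀ D)) (trans (sym (*-assoc (q zero) (ℕ→ℚ d₀) (ℕ→ℚ D)))
    (trans (cong (_* ℕ→ℚ D) (*-denominator (q zero))) (sym (ℤ→ℚ-* (↥ (q zero)) (ℤ.+ D)))))
  eq (suc i) = trans (cong (q (suc i) *_) (ℕ→ℚ-* d₀ D)) (trans (swap (q (suc i)) (ℕ→ℚ d₀) (ℕ→ℚ D))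
    (trans (cong (_* ℕ→ℚ d₀) (qD≡u i)) (sym (ℤ→ℚ-* (u i) (ℤ.+ d₀)))))

dot-integral : ∀ (z a : Fin n → ℤ) → ∃[ k ] dot (λ i → ℤ→ℚ (z i)) (λ i → ℤ→ℚ (a i)) ≡ ℤ→ℚ k
dot-integral {zero}  z a = ℤ.+ 0 , refl
dot-integral {suc n} z a with dot-integral (λ i → z (suc i)) (λ i → a (suc i))
... | k , eq = z zero ℤ.* a zero ℤ.+ k ,
  trans (cong₂ _+_ (sym (ℤ→ℚ-* (z zero) (a zero))) eq) (sym (ℤ→ℚ-+ (z zero ℤ.* a zero) k))

-- r = ⌊e/D⌋ / e.
truncate-1/ : ∀ D .{{_ : ℕ.NonZero D}} N e s → D ℕ.* N ℕ.≤ e → 0ℚ < s → s * ℕ→ℚ e ≡ 1ℚ →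
  ∃[ r ] ∃[ ε ] (r * ℕ→ℚ e ≡ ℕ→ℚ (e ℕ./ D) × r * ℕ→ℚ D ≡ 1ℚ - ε × 0ℚ ≤ ε × ε * ℕ→ℚ N ≤ 1ℚ)
truncate-1/ D N e s DN≤e 0<s se≡1 = r , ε , re≡a , rD≡1-ε , *-nonneg (ℕ→ℚ-nonneg ρ) (<⇒≤ 0<s) , εN≤1
  where
  a = e ℕ./ D
  ρ = e ℕ.% D
  r = ℕ→ℚ a * s
  -- The relative error is the remainder over `e`, hence at most `D / e`, which `D * N ≤ e` bounds
  -- by `1 / N`.
  ε = ℕ→ℚ ρ * s

  re≡a : r * ℕ→ℚ e ≡ ℕ→ℚ a
  re≡a = trans (*-assoc (ℕ→ℚ a) s (ℕ→ℚ e)) (trans (cong (ℕ→ℚ a *_) se≡1) (*-identityʳ (ℕ→ℚ a)))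

  e≡ : ℕ→ℚ e ≡ ℕ→ℚ ρ + ℕ→ℚ a * ℕ→ℚ D
  e≡ = trans (cong ℕ→ℚ (ℕ.m≡m%n+[m/n]*n e D))
       (trans (ℕ→ℚ-+ ρ (a ℕ.* D)) (cong (ℕ→ℚ ρ +_) (ℕ→ℚ-* a D)))

  rD≡1-ε : r * ℕ→ℚ D ≡ 1ℚ - ε
  rD≡1-ε = trans (regroup (ℕ→ℚ a) s (ℕ→ℚ D) (ℕ→ℚ ρ)) (cong (_- ε) (trans (cong (s *_) (sym e≡)) se≡1))
    where
    regroup : ∀ a s D ρ → a * s * D ≡ s * (ρ + a * D) - ρ * s
    regroup = solve-∀ ℚ-ring

  εN≤1 : ε * ℕ→ℚ N ≤ 1ℚ
  εN≤1 = begin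
    ε * ℕ→ℚ N                ≡⟨ regroup (ℕ→ℚ ρ) s (ℕ→ℚ N) ⟩
    s * (ℕ→ℚ ρ * ℕ→ℚ N)      ≡⟨ cong (s *_) (ℕ→ℚ-* ρ N) ⟨
    s * ℕ→ℚ (ρ ℕ.* N)        ≤⟨ *-monoˡ (<⇒≤ 0<s) (ℕ→ℚ-mono (ℕ.≤-trans (ℕ.*-monoˡ-≤ N (ℕ.m%n≤n e D)) DN≤e)) ⟩
    s * ℕ→ℚ e                ≡⟨ se≡1 ⟩
    1ℚ                       ∎
    where
    open ≤-Reasoning
    regroup : ∀ ρ s N → ρ * s * N ≡ s * (ρ * N)
    regroup = solve-∀ ℚ-ring

≤-multiple-of-positive : ∀ (y x : Fin n → ℚ) → ∃[ N ] (∀ i → 0ℚ < y i → x i ≤ ℕ→ℚ N * y i)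
≤-multiple-of-positive y x = N , λ i 0<yi → ≤-trans (proj₂ (quotient i) 0<yi)
  (subst₂ _≤_ (*-comm (y i) _) (*-comm (y i) _) (*-monoˡ (<⇒≤ 0<yi) (proj₂ N-bounds i)))
  where
  quotient : ∀ i → ∃[ q ] (0ℚ < y i → x i ≤ q * y i)
  quotient i with 0ℚ <? y i
  -- Nothing is claimed at such an index, so zero is a placeholder; elsewhere `N` has to bound the
  -- quotient of `x i` by `y i`.
  ... | no  0≮yi = 0ℚ , λ 0<yi → ⊥-elim (0≮yi 0<yi)
  ... | yes 0<yi with inverse 0<yi
  ...   | s , _ , syi≡1 = x i * s , λ _ → ≤-reflexive (sym
          (trans (*-assoc (x i) s (y i)) (trans (cong (x i *_) syi≡1) (*-identityʳ (x i)))))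
  N-bounds = ≤-natural-uniform (λ i → proj₁ (quotient i))
  N = proj₁ N-bounds

-- The p-adic rationals and their density.

module PAdic (p : ℕ) where

  padic-ℤ : ∀ a → IsPAdic p (ℤ→ℚ a)
  padic-ℤ a = 0 , a , *-identityʳ (ℤ→ℚ a)

  ℕ→ℚ-^-+ : ∀ k l → ℕ→ℚ (p ℕ.^ (k ℕ.+ l)) ≡ ℕ→ℚ (p ℕ.^ k) * ℕ→ℚ (p ℕ.^ l)
  ℕ→ℚ-^-+ k l = trans (cong ℕ→ℚ (ℕ.^-distribˡ-+-* p k l)) (ℕ→ℚ-* (p ℕ.^ k) (p ℕ.^ l))

  padic-+ : ∀ q r → IsPAdic p q → IsPAdic p r → IsPAdic p (q + r)
  padic-+ q r (k , a , qpᵏ≡a) (l , b , rpˡ≡b) = k ℕ.+ l , a ℤ.* pˡ ℤ.+ b ℤ.* pᵏ , (begin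
    (q + r) * ℕ→ℚ (p ℕ.^ (k ℕ.+ l))              ≡⟨ cong ((q + r) *_) (ℕ→ℚ-^-+ k l) ⟩
    (q + r) * (ℤ→ℚ pᵏ * ℤ→ℚ pˡ)                  ≡⟨ expand q r (ℤ→ℚ pᵏ) (ℤ→ℚ pˡ) ⟩
    q * ℤ→ℚ pᵏ * ℤ→ℚ pˡ + r * ℤ→ℚ pˡ * ℤ→ℚ pᵏ    ≡⟨ cong₂ (λ s t → s * ℤ→ℚ pˡ + t * ℤ→ℚ pᵏ) qpᵏ≡a rpˡ≡b ⟩
    ℤ→ℚ a * ℤ→ℚ pˡ + ℤ→ℚ b * ℤ→ℚ pᵏ              ≡⟨ cong₂ _+_ (ℤ→ℚ-* a pˡ) (ℤ→ℚ-* b pᵏ) ⟨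
    ℤ→ℚ (a ℤ.* pˡ) + ℤ→ℚ (b ℤ.* pᵏ)              ≡⟨ ℤ→ℚ-+ (a ℤ.* pˡ) (b ℤ.* pᵏ) ⟨
    ℤ→ℚ (a ℤ.* pˡ ℤ.+ b ℤ.* pᵏ)                  ∎)
    where
    open ≡-Reasoning
    pᵏ = ℤ.+ (p ℕ.^ k)
    pˡ = ℤ.+ (p ℕ.^ l)
    expand : ∀ q r s t → (q + r) * (s * t) ≡ q * s * t + r * t * s
    expand = solve-∀ ℚ-ring

  padic-* : ∀ q r → IsPAdic p q → IsPAdic p r → IsPAdic p (q * r)
  padic-* q r (k , a , qpᵏ≡a) (l , b , rpˡ≡b) = k ℕ.+ l , a ℤ.* b , (begin
    q * r * ℕ→ℚ (p ℕ.^ (k ℕ.+ l))      ≡⟨ cong (q * r *_) (ℕ→ℚ-^-+ k l) ⟩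
    q * r * (ℤ→ℚ pᵏ * ℤ→ℚ pˡ)          ≡⟨ interchange q r (ℤ→ℚ pᵏ) (ℤ→ℚ pˡ) ⟩
    q * ℤ→ℚ pᵏ * (r * ℤ→ℚ pˡ)          ≡⟨ cong₂ _*_ qpᵏ≡a rpˡ≡b ⟩
    ℤ→ℚ a * ℤ→ℚ b                      ≡⟨ ℤ→ℚ-* a b ⟨
    ℤ→ℚ (a ℤ.* b)                      ∎)
    where
    open ≡-Reasoning
    pᵏ = ℤ.+ (p ℕ.^ k)
    pˡ = ℤ.+ (p ℕ.^ l)
    interchange : ∀ q r s t → q * r * (s * t) ≡ q * s * (r * t)
    interchange = solve-∀ ℚ-ring

  module _ (1<p : 1 ℕ.< p) where

    n<pⁿ : ∀ k → k ℕ.< p ℕ.^ k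
    n<pⁿ zero    = ℕ.s≤s ℕ.z≤n
    n<pⁿ (suc k) = ℕ.≤-<-trans (n<pⁿ k) (ℕ.^-monoʳ-< p 1<p (ℕ.n<1+n k))

    padic-approximates-1/ : ∀ D .{{_ : ℕ.NonZero D}} N →
      ∃[ r ] ∃[ ε ] (IsPAdic p r × r * ℕ→ℚ D ≡ 1ℚ - ε × 0ℚ ≤ ε × ε * ℕ→ℚ N ≤ 1ℚ)
    padic-approximates-1/ D N =
      let s , 0<s , se≡1 = inverse (<-≤-trans 0<1 (ℕ→ℚ-mono {1} (ℕ.≤-trans (ℕ.s≤s ℕ.z≤n) DN<e)))
          r , ε , re≡a , rest = truncate-1/ D N e s (ℕ.<⇒≤ DN<e) 0<s se≡1
      in  r , ε , (D ℕ.* N , ℤ.+ (e ℕ./ D) , re≡a) , rest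
      where
      -- The exponent `D * N` is large enough because every `k` is below the `k`-th power of `p`.
      e = p ℕ.^ (D ℕ.* N)
      DN<e = n<pⁿ (D ℕ.* N)

    -- Moving from z towards y by the factor t = r D, where D clears the denominators of y - z
    -- and r ≈ 1/D, keeps the entries p-adic and ends near y.
    padic-near-positive : ∀ (y z : Fin m → ℚ) → PAdicVec p z →
      ∃[ t ] (PAdicVec p (λ i → z i + t * (y i + - 1ℚ * z i)) ×
              (∀ i → 0ℚ < y i → 0ℚ ≤ z i + t * (y i + - 1ℚ * z i)))
    padic-near-positive {m} y z z-padic =
      let D , u , D≢0 , xD≡u = common-denominator x
          N , x≤Ny = ≤-multiple-of-positive y x
          r , ε , r-padic , rD≡1-ε , 0≤ε , εN≤1 = padic-approximates-1/ D {{D≢0}} N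
      in  r * ℕ→ℚ D , padic D u xD≡u r r-padic , nonneg N x≤Ny (r * ℕ→ℚ D) ε rD≡1-ε 0≤ε εN≤1
      where
      x : Fin m → ℚ
      x i = y i + - 1ℚ * z i
      padic : ∀ D (u : Fin m → ℤ) → (∀ i → x i * ℕ→ℚ D ≡ ℤ→ℚ (u i)) →
        ∀ r → IsPAdic p r → PAdicVec p (λ i → z i + r * ℕ→ℚ D * x i)
      padic D u xD≡u r r-padic i = padic-+ (z i) (r * ℕ→ℚ D * x i) (z-padic i) (subst (IsPAdic p)
        (trans (cong (r *_) (sym (xD≡u i))) (regroup r (x i) (ℕ→ℚ D))) (padic-* r (ℤ→ℚ (u i)) r-padic (padic-ℤ (u i))))
        where
        regroup : ∀ r x D → r * (x * D) ≡ r * D * x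
        regroup = solve-∀ ℚ-ring
      -- With `t = 1 - ε` the point reached is `y - ε x`, and where `y` is positive `ε x` is at most
      -- `ε N y`, hence at most `y`.
      nonneg : ∀ N → (∀ i → 0ℚ < y i → x i ≤ ℕ→ℚ N * y i) →
        ∀ t ε → t ≡ 1ℚ - ε → 0ℚ ≤ ε → ε * ℕ→ℚ N ≤ 1ℚ →
        ∀ i → 0ℚ < y i → 0ℚ ≤ z i + t * x i
      nonneg N x≤Ny t ε t≡1-ε 0≤ε εN≤1 i 0<yi = subst (0ℚ ≤_)
        (trans (regroup (y i) (z i) ε) (cong (λ t → z i + t * x i) (sym t≡1-ε))) (diff-nonneg εx≤y)
        where
        regroup : ∀ y z ε → y - ε * (y + - 1ℚ * z) ≡ z + (1ℚ - ε) * (y + - 1ℚ * z)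
        regroup = solve-∀ ℚ-ring
        εx≤y : ε * x i ≤ y i
        εx≤y = begin
          ε * x i                ≤⟨ *-monoˡ 0≤ε (x≤Ny i 0<yi) ⟩
          ε * (ℕ→ℚ N * y i)      ≡⟨ rearrange ε (ℕ→ℚ N) (y i) ⟩
          y i * (ε * ℕ→ℚ N)      ≤⟨ *-monoˡ (<⇒≤ 0<yi) εN≤1 ⟩
          y i * 1ℚ               ≡⟨ *-identityʳ (y i) ⟩
          y i                    ∎
          where
          open ≤-Reasoning
          rearrange : ∀ ε N y → ε * (N * y) ≡ y * (ε * N)
          rearrange = solve-∀ ℚ-ring

-- The cycle of implications between the three statements.

module _ (p : ℕ) {m n : ℕ} (A : Fin m → Fin n → ℤ) (b : Fin m → ℤ) where

  open PAdic p

  private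
    V : Fin m → Fin n → ℚ
    V i j = ℤ→ℚ (A i j)

    d : Fin m → ℚ
    d i = ℤ→ℚ (b i)

    module LP (w : Fin n → ℤ) = LinearProgram V d (λ j → ℤ→ℚ (w j))

  -- Being an implicit equality quantifies over all face points and comes with no decision
  -- procedure. Equality of rationals is decidable, so the double negation can be removed there; the
  -- converse lemma works the same way.
  supported⇒tight : ∀ c δ {x y} → InFace A b c δ x → SupportedOn (ImplicitEq A b c δ) y →
    ∀ i → y i ≢ 0ℚ → dot (V i) x ≡ d i
  supported⇒tight c δ {x} x∈F supp i yi≢0 =
    decidable-stable (dot (V i) x ≟ d i) (λ neq → yi≢0 (supp i (λ implicit → neq (implicit x x∈F))))

  tight⇒supported : ∀ c δ {y} → (∀ x → InFace A b c δ x → ∀ i → y i ≢ 0ℚ → dot (V i) x ≡ d i) →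
    SupportedOn (ImplicitEq A b c δ) y
  tight⇒supported c δ {y} tight i ¬implicit =
    decidable-stable (y i ≟ 0ℚ) (λ yi≢0 → ¬implicit (λ x x∈F → tight x x∈F i yi≢0))

  -- The face point `x₀` certifies that `y` is optimal. All face points then share its value, so
  -- complementary slackness for `y′` holds at each of them, as an implicit equality requires.
  totally-dual⇒cone : TotallyDualPAdic p A b → AllFacesCone p A b
  totally-dual⇒cone td c δ (_ , x₀ , x₀∈F) w (y , 0≤y , supp , Vy≡w) =
    let y′ , (dual′ , y′-optimal) , y′-padic = td w (y , (0≤y , Vy≡w) , y-optimal)
    in  y′ , proj₁ dual′ , tight⇒supported c δ (tight y′ dual′ y′-optimal) , y′-padic , proj₂ dual′
    where
    value : ∀ {x} → InFace A b c δ x → dot d y ≡ dot (λ j → ℤ→ℚ (w j)) x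
    value x∈F = LP.tight⇒equal-value w Vy≡w (supported⇒tight c δ x∈F supp)
    y-optimal : ∀ y′ → DualFeasible A w y′ → dot d y ≤ dot d y′
    y-optimal y′ dual′ = subst (_≤ dot d y′) (sym (value x₀∈F)) (LP.weak-duality w (proj₁ x₀∈F) dual′)
    tight : ∀ y′ → DualFeasible A w y′ → (∀ y″ → DualFeasible A w y″ → dot d y′ ≤ dot d y″) →
      ∀ x → InFace A b c δ x → ∀ i → y′ i ≢ 0ℚ → dot (V i) x ≡ d i
    tight y′ dual′ y′-optimal x x∈F = LP.complementary-slackness w (proj₁ x∈F) dual′
      (≤-trans (y′-optimal y (0≤y , Vy≡w)) (≤-reflexive (value x∈F)))

  -- Zero is shifted by zero so that the support is preserved. The factor `1ℚ` fits the shape of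
  -- `dot-linˡ`.
  nonneg-shift : ∀ q → ∃[ k ] (0ℚ ≤ q + 1ℚ * ℕ→ℚ k × (q ≡ 0ℚ → k ≡ 0))
  nonneg-shift q with q ≟ 0ℚ
  ... | yes q≡0 = 0 , ≤-reflexive (sym (cong (_+ 1ℚ * ℕ→ℚ 0) q≡0)) , λ _ → refl
  ... | no  q≢0 with ≤-natural (- q)
  ...   | k , -q≤k = k , subst (0ℚ ≤_) (regroup q (ℕ→ℚ k)) (diff-nonneg -q≤k) , λ q≡0 → ⊥-elim (q≢0 q≡0)
    where
    regroup : ∀ q k → k - - q ≡ q + 1ℚ * k
    regroup = solve-∀ ℚ-ring

  cone⇒subspace : AllFacesCone p A b → AllFacesSubspace p A b
  cone⇒subspace cone c δ face w (y , supp , Vy≡w) =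
    let z , _ , supp-z , z-padic , Vz≡w′ = cone c δ face w′ (y⁺ , 0≤y⁺ , supp⁺ , Vy⁺≡w′)
    in  (λ i → z i + - 1ℚ * ℕ→ℚ (N i)) ,
        (λ i ¬S → cong₂ (λ s k → s + - 1ℚ * ℕ→ℚ k) (supp-z i ¬S) (N-zero i ¬S)) ,
        (λ i → padic-+ (z i) (- 1ℚ * ℕ→ℚ (N i)) (z-padic i)
               (padic-* (- 1ℚ) (ℕ→ℚ (N i)) (padic-ℤ (ℤ.- ℤ.+ 1)) (padic-ℤ (ℤ.+ N i)))) ,
        λ j → trans (dot-linˡ (- 1ℚ) z (λ i → ℕ→ℚ (N i)) (λ i → V i j))
          (trans (cong₂ (λ s t → s + - 1ℚ * t) (trans (Vz≡w′ j) (ℤ→ℚ-+ (w j) (shift j))) (VN≡shift j))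
                 (cancel (ℤ→ℚ (w j)) (ℤ→ℚ (shift j))))
    where
    N : Fin m → ℕ
    N i = proj₁ (nonneg-shift (y i))
    N-zero : ∀ i → ¬ ImplicitEq A b c δ i → N i ≡ 0
    N-zero i ¬S = proj₂ (proj₂ (nonneg-shift (y i))) (supp i ¬S)
    -- A natural combination of integral rows is integral, so the cone property applies to `w′`.
    shift : Fin n → ℤ
    shift j = proj₁ (dot-integral (λ i → ℤ.+ N i) (λ i → A i j))
    VN≡shift : ∀ j → comb V (λ i → ℕ→ℚ (N i)) j ≡ ℤ→ℚ (shift j)
    VN≡shift j = proj₂ (dot-integral (λ i → ℤ.+ N i) (λ i → A i j))
    y⁺ : Fin m → ℚ
    y⁺ i = y i + 1ℚ * ℕ→ℚ (N i)
    w′ : Fin n → ℤ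
    w′ j = w j ℤ.+ shift j
    0≤y⁺ : Nonneg y⁺
    0≤y⁺ i = proj₁ (proj₂ (nonneg-shift (y i)))
    supp⁺ : SupportedOn (ImplicitEq A b c δ) y⁺
    supp⁺ i ¬S = cong₂ (λ s k → s + 1ℚ * ℕ→ℚ k) (supp i ¬S) (N-zero i ¬S)
    Vy⁺≡w′ : CombEq A y⁺ w′
    Vy⁺≡w′ j = trans (dot-linˡ 1ℚ y (λ i → ℕ→ℚ (N i)) (λ i → V i j))
      (trans (cong₂ _+_ (Vy≡w j) (trans (*-identityˡ _) (VN≡shift j))) (sym (ℤ→ℚ-+ (w j) (shift j))))
    cancel : ∀ a b → a + b + - 1ℚ * b ≡ a
    cancel = solve-∀ ℚ-ring

  strictly-complementary⇒padic-optimal : 1 ℕ.< p → AllFacesSubspace p A b →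
    ∀ w (let c = λ j → ℤ→ℚ (w j)) δ → (∀ y → DualFeasible A w y → δ ≤ dot d y) →
    ∃ (InFace A b c δ) →
    ∀ ȳ → DualFeasible A w ȳ → dot d ȳ ≤ δ →
    (∀ i → 0ℚ < ȳ i ⊎ ∃[ x ] (InFace A b c δ x × dot (V i) x < d i)) →
    ∃[ y ] (DualOptimal A b w y × PAdicVec p y)
  strictly-complementary⇒padic-optimal 1<p subspace w δ δ≤ (x₀ , x₀∈F) ȳ dual-ȳ dȳ≤δ positive-or-strict =
    let z , supp-z , z-padic , Vz≡w = subspace c δ face w (ȳ , supp-ȳ , proj₂ dual-ȳ)
        t , y-padic , y-nonneg = padic-near-positive 1<p ȳ z z-padic
    in  (λ i → z i + t * (ȳ i + - 1ℚ * z i)) , conclude z supp-z Vz≡w t y-nonneg , y-padic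
    where
    c : Fin n → ℚ
    c j = ℤ→ℚ (w j)
    S = ImplicitEq A b c δ
    -- The objective `w` defines the optimal face; weak duality against `ȳ` shows that its
    -- inequality is valid.
    face : NonemptyFace A b c δ
    face = (λ x x∈P → ≤-trans (LP.weak-duality w x∈P dual-ȳ) dȳ≤δ) , x₀ , x₀∈F
    supp-ȳ : SupportedOn S ȳ
    supp-ȳ = tight⇒supported c δ λ x (x∈P , cx≡δ) →
      LP.complementary-slackness w x∈P dual-ȳ (≤-trans dȳ≤δ (≤-reflexive (sym cx≡δ)))
    conclude : ∀ z → SupportedOn S z → CombEq A z w → ∀ t →
      (∀ i → 0ℚ < ȳ i → 0ℚ ≤ z i + t * (ȳ i + - 1ℚ * z i)) →
      DualOptimal A b w (λ i → z i + t * (ȳ i + - 1ℚ * z i))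
    conclude z supp-z Vz≡w t y-nonneg = (0≤y , Vy≡w) , λ y′ dual′ → begin
        dot d y     ≡⟨ LP.tight⇒equal-value w Vy≡w (supported⇒tight c δ x₀∈F supp-y) ⟩
        dot c x₀    ≡⟨ proj₂ x₀∈F ⟩
        δ           ≤⟨ δ≤ y′ dual′ ⟩
        dot d y′    ∎
      where
      open ≤-Reasoning
      y : Fin m → ℚ
      y i = z i + t * (ȳ i + - 1ℚ * z i)
      collapse : ∀ a t → a + t * (a + - 1ℚ * a) ≡ a
      collapse = solve-∀ ℚ-ring
      supp-y : SupportedOn S y
      supp-y i ¬S = trans (cong₂ (λ a b → a + t * (b + - 1ℚ * a)) (supp-z i ¬S) (supp-ȳ i ¬S)) (collapse 0ℚ t)
      0≤y : Nonneg y
      -- Where `ȳ` is not known to be positive, some face point is strict, so the row is not an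
      -- implicit equality and `y` vanishes there.
      0≤y i with positive-or-strict i
      ... | inj₁ 0<ȳi = y-nonneg i 0<ȳi
      ... | inj₂ (x , x∈F , Vx<d) =
        ≤-reflexive (sym (supp-y i (λ implicit → <-irrefl (implicit x x∈F) Vx<d)))
      -- Both `z` and `ȳ` represent `w`, hence so does every point of the line through them.
      Vy≡w : CombEq A y w
      Vy≡w j = ≡.begin
        dot y col                                        ≡.≡⟨ dot-linˡ t z (λ i → ȳ i + - 1ℚ * z i) col ⟩
        dot z col + t * dot (λ i → ȳ i + - 1ℚ * z i) col ≡.≡⟨ cong (λ q → dot z col + t * q) (dot-linˡ (- 1ℚ) ȳ z col) ⟩
        dot z col + t * (dot ȳ col + - 1ℚ * dot z col)   ≡.≡⟨ cong₂ (λ a b → a + t * (b + - 1ℚ * a)) (Vz≡w j) (proj₂ dual-ȳ j) ⟩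
        c j + t * (c j + - 1ℚ * c j)                     ≡.≡⟨ collapse (c j) t ⟩
        c j                                              ≡.∎
        where
        module ≡ = ≡-Reasoning
        col = λ i → V i j

  subspace⇒totally-dual : 1 ℕ.< p → AllFacesSubspace p A b → TotallyDualPAdic p A b
  subspace⇒totally-dual 1<p subspace w (y* , dual* , optimal*) =
    let ȳ , (dual-ȳ , dȳ≤δ) , positive-or-strict = strict-complementarity
    in  strictly-complementary⇒padic-optimal 1<p subspace w (dot d y*) optimal* face-nonempty
          ȳ dual-ȳ dȳ≤δ positive-or-strict
    where open StrictComplementarity V d (λ j → ℤ→ℚ (w j)) y* dual* optimal*

theorem1p1 : (p : ℕ) → Prime p → (m n : ℕ) → (A : Fin m → Fin n → ℤ) → (b : Fin m → ℤ) →
    (TotallyDualPAdic p A b ⇔ AllFacesCone p A b) × (TotallyDualPAdic p A b ⇔ AllFacesSubspace p A b)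
theorem1p1 p (prime _) m n A b =
  mk⇔ 1⇒2 (λ cone → 3⇒1 (2⇒3 cone)) , mk⇔ (λ td → 2⇒3 (1⇒2 td)) 3⇒1
  where
  1⇒2 = totally-dual⇒cone p A b
  2⇒3 = cone⇒subspace p A b
  3⇒1 = subspace⇒totally-dual p A b (ℕ.nonTrivial⇒n>1 p)
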